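{- Let $\mathcal{H}$ be a pseudohalfplane hypergraph on a finite totally ordered vertex set $V$ such that every triple of hyperedges of $\mathcal{H}$ has a common vertex. Then there exists a set of at most $2$ vertices of $V$ that intersects every hyperedge of $\mathcal{H}$.
   Context: A hypergraph $\mathcal{F}$ on a totally ordered finite vertex set $V$ (a family of subsets of $V$) is ABA-free if there are no two hyperedges $A,B\in\mathcal{F}$ and vertices $x<y<z$ with $x,z\in A\setminus B$ and $y\in B\setminus A$. For a family $\mathcal{F}$ of subsets of $V$ let $\bar{\mathcal{F}}=\{V\setminus F: F\in\mathcal{F}\}$. A hypergraph $\mathcal{H}$ on $V$ is a pseudohalfplane hypergraph if there exists an ABA-free hypergraph $\mathcal{F}$ on $V$ such that $\mathcal{H}\subseteq\mathcal{F}\cup\bar{\mathcal{F}}$. -}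

module Defs where

open import Data.Nat using (ℕ)
open import Data.Fin using (Fin; _<_)
open import Data.Fin.Subset using (Subset; _∈_; _∉_; ∁)
open import Data.List using (List; map)
import Data.List.Membership.Propositional as LM
open import Data.Product using (_×_)
open import Data.Sum using (_⊎_)
open import Relation.Nullary using (¬_)

-- Vertex set V = Fin n with its natural total order.
-- A hypergraph on V is a finite family of subsets, given as a list.
Hypergraph : ℕ → Set
Hypergraph n = List (Subset n)

ABA-free : ∀ {n} → Hypergraph n → Set
ABA-free {n} F =
  ∀ (A B : Subset n) → A LM.∈ F → B LM.∈ F →
  ∀ (x y z : Fin n) → x < y → y < z →
  ¬ ((x ∈ A × x ∉ B) × (z ∈ A × z ∉ B) × (y ∈ B × y ∉ A))

complementFamily : ∀ {n} → Hypergraph n → Hypergraph n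
complementFamily F = map ∁ F

IsPseudohalfplane : ∀ {n} → Hypergraph n → Set
IsPseudohalfplane {n} H =
  Data.Product.Σ (Hypergraph n) λ F →
    ABA-free F ×
    (∀ (E : Subset n) → E LM.∈ H → E LM.∈ F ⊎ E LM.∈ complementFamily F)

{-# OPTIONS --safe #-}
-- In the plane: let K_E be the convex hull of the points of E. By Helly's theorem the
-- sets K_E have a common point, and an extreme common point lies on a segment pq between
-- two points of some edge; every halfplane containing a point of pq contains p or q.
--
-- Combinatorially, split the edges into "up" edges (in F) and "down" edges (complements of
-- members of F), and sweep a gap v through the vertex order.  At each gap take the
-- highest up edge A and the segment pq of its lower hull that crosses the gap.  If pq does
-- not hit all edges, then it misses a down edge D, and A ∩ D lies entirely to the left of p
-- or entirely to the right of q.  The first gap is not of the former kind, the last one is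
-- not of the latter, and a gap of the right kind is never followed by one of the left kind.
module Submission where

open import Defs
open import Data.Nat using (ℕ; zero; suc; _+_; _≤_; z≤n; s≤s; _≤?_) renaming (_<_ to _<ℕ_; _<?_ to _<ℕ?_)
import Data.Nat.Properties as ℕ
open import Data.Bool.Properties using () renaming (_≟_ to _≟ᵇ_)
open import Data.Fin using (Fin; toℕ; _<_; _≟_)
open import Data.Fin.Properties using (any?; _<?_; <-cmp; <-irrefl; <-isStrictTotalOrder; toℕ<n)
open import Data.Fin.Induction using (<-wellFounded; >-wellFounded)
open import Data.Fin.Subset using (inside; outside; Subset; _∈_; _∉_; _⊂_; _-_; ∁; ⊤)
open import Data.Fin.Subset.Properties using (_∈?_; ∈⊤; x∈p⇒x∉∁p; x∈∁p⇒x∉p; x∉∁p⇒x∈p; x∉p⇒x∈∁p; x∈p∧x≢y⇒x∈p-y; x∈p⇒p-x⊂p; p─q⊆p; ∪-∩-booleanAlgebra)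
open import Data.Fin.Subset.Induction using (⊂-wellFounded)
open import Algebra.Lattice.Properties.BooleanAlgebra using (¬-involutive)
open import Data.List using (List; []; _∷_; _++_; length; filter)
open import Data.List.Relation.Unary.Any using (Any; here; there)
import Data.List.Relation.Unary.Any as Any
import Data.List.Membership.Propositional as LM
open import Data.List.Membership.Propositional using (find; lose)
open import Data.List.Membership.Propositional.Properties using (∈-++⁺ˡ; ∈-++⁺ʳ; ∈-++⁻; ∈-filter⁺; ∈-filter⁻; ∈-map⁻)
import Data.List.Membership.DecPropositional as DecMembership
open import Data.Product using (Σ; ∃; ∃₂; _×_; _,_; proj₁; proj₂)
open import Data.Sum using (_⊎_; inj₁; inj₂; [_,_]′)
open import Data.Vec using (_∷_; here; there)
open import Data.Vec.Properties using (≡-dec)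
open import Function using (flip)
open import Induction.WellFounded using (Acc; acc; WellFounded)
open import Level using (0ℓ)
open import Relation.Binary using (Rel; IsStrictTotalOrder; tri<; tri≈; tri>)
open import Relation.Binary.Definitions using () renaming (Decidable to Decidable₂)
import Relation.Binary.Construct.Flip.EqAndOrd as Flip
open import Relation.Binary.PropositionalEquality using (_≡_; _≢_; refl; sym; subst)
open import Relation.Nullary using (¬_; Dec; yes; no; contradiction)
open import Relation.Nullary.Decidable using (_×-dec_; ¬?)
open import Relation.Unary using (Pred; Decidable)

private variable
  n : ℕ

-- Extremal elements

∃-minimal : {_⊏_ : Rel (Fin n) 0ℓ} → WellFounded _⊏_ → Decidable₂ _⊏_ →
  {P : Pred (Fin n) 0ℓ} → Decidable P → ∃ P →
  ∃ λ m → P m × (∀ {j} → P j → ¬ j ⊏ m)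
∃-minimal {_⊏_ = _⊏_} wf _⊏?_ {P} P? (i , Pi) = go i (wf i) Pi
  where
  go : ∀ i → Acc _⊏_ i → P i → ∃ λ m → P m × (∀ {j} → P j → ¬ j ⊏ m)
  go i (acc rs) Pi with any? (λ j → P? j ×-dec (j ⊏? i))
  ... | yes (j , Pj , j⊏i) = go j (rs j⊏i) Pj
  ... | no ∄j = i , Pi , λ Pj j⊏i → ∄j (_ , Pj , j⊏i)

∃-least : {P : Pred (Fin n) 0ℓ} → Decidable P → ∃ P →
  ∃ λ m → P m × (∀ {j} → P j → ¬ j < m)
∃-least = ∃-minimal <-wellFounded _<?_

∃-greatest : {P : Pred (Fin n) 0ℓ} → Decidable P → ∃ P →
  ∃ λ m → P m × (∀ {j} → P j → ¬ m < j)
∃-greatest = ∃-minimal >-wellFounded (flip _<?_)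

-- Transitivity is asked of members only, since `above-trans` supplies it only within an
-- alternation-free family.
∃-maximal-∈ : {X : Set} {_≺_ : Rel X 0ℓ} → Decidable₂ _≺_ → (∀ {x} → ¬ x ≺ x) →
  ∀ x xs → (∀ {a b c} → a LM.∈ (x ∷ xs) → b LM.∈ (x ∷ xs) → c LM.∈ (x ∷ xs) →
            a ≺ b → b ≺ c → a ≺ c) →
  ∃ λ m → m LM.∈ (x ∷ xs) × (∀ {y} → y LM.∈ (x ∷ xs) → ¬ m ≺ y)
∃-maximal-∈ _≺?_ irr x [] tr = x , here refl , λ { (here refl) → irr }
∃-maximal-∈ _≺?_ irr x (x′ ∷ xs) tr
  with ∃-maximal-∈ _≺?_ irr x′ xs (λ a∈ b∈ c∈ → tr (there a∈) (there b∈) (there c∈))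
... | m , m∈ , max with m ≺? x
...   | yes m≺x = x , here refl , λ
        { (here refl) → irr
        ; (there y∈) x≺y → max y∈ (tr (there m∈) (here refl) (there y∈) m≺x x≺y) }
...   | no m⊀x = m , there m∈ , λ { (here refl) → m⊀x ; (there y∈) → max y∈ }

x∉p-x : ∀ (p : Subset n) x → x ∉ p - x
x∉p-x (outside ∷ p) Fin.zero ()
x∉p-x (inside ∷ p) Fin.zero ()
x∉p-x (_ ∷ p) (Fin.suc x) (there x∈) = x∉p-x p x x∈

-- Unskippable vertices: the combinatorial lower hull

-- Geometrically, a lower halfplane `D` contains `b` and `c` but not `u`, so `u` lies above the
-- segment `bc` and off the lower hull of `A`. The order is a parameter so that left-right mirror
-- images are instances at `flip _<_`.
Skips : Rel (Fin n) 0ℓ → Subset n → Subset n → Fin n → Set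
Skips _⊏_ D A u =
  u ∉ D × (∃ λ b → b ⊏ u × b ∈ A × b ∈ D) × (∃ λ c → u ⊏ c × c ∈ A × c ∈ D)

AlternationFree : Rel (Fin n) 0ℓ → Hypergraph n → Set
AlternationFree {n} _⊏_ 𝒟 =
  ∀ {A B : Subset n} → A LM.∈ 𝒟 → B LM.∈ 𝒟 → ∀ {x y z} → x ⊏ y → y ⊏ z →
  x ∈ A → x ∉ B → z ∈ A → z ∉ B → y ∈ B → y ∈ A

-- If a is removed from A and a was the left end of the skip of u by D₂, then either D₂
-- still skips u, with one of the ends b₁, c₁ of the skip of a in place of a, or D₁ skips u.
reroute : {_⊏_ : Rel (Fin n) 0ℓ} → IsStrictTotalOrder _≡_ _⊏_ →
  {𝒟 : Hypergraph n} → AlternationFree _⊏_ 𝒟 →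
  ∀ {A D₁ D₂ a u} → D₁ LM.∈ 𝒟 → D₂ LM.∈ 𝒟 → Skips _⊏_ D₁ A a →
  a ∈ D₂ → a ⊏ u → u ∉ D₂ → (∃ λ c → u ⊏ c × c ∈ A × c ∈ D₂) →
  ∃ λ D → D LM.∈ 𝒟 × Skips _⊏_ D (A - a) u
reroute {_⊏_ = _⊏_} sto {𝒟} alt {A} {D₁} {D₂} {a} {u} D₁∈ D₂∈
        (a∉D₁ , (b₁ , b₁⊏a , b₁∈A , b₁∈D₁) , (c₁ , a⊏c₁ , c₁∈A , c₁∈D₁))
        a∈D₂ a⊏u u∉D₂ (c₂ , u⊏c₂ , c₂∈A , c₂∈D₂) = by-cases (b₁ ∈? D₂) (c₁ ∈? D₂)
  where
  open IsStrictTotalOrder sto using (irrefl; compare) renaming (trans to ⊏-trans)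

  b₁∈A-a : b₁ ∈ A - a
  b₁∈A-a = x∈p∧x≢y⇒x∈p-y b₁∈A λ b₁≡a → irrefl b₁≡a b₁⊏a

  after : ∀ {c} → a ⊏ c → c ∈ A → c ∈ A - a
  after a⊏c c∈A = x∈p∧x≢y⇒x∈p-y c∈A λ c≡a → irrefl (sym c≡a) a⊏c

  right₂ : ∃ λ c → u ⊏ c × c ∈ A - a × c ∈ D₂
  right₂ = c₂ , u⊏c₂ , after (⊏-trans a⊏u u⊏c₂) c₂∈A , c₂∈D₂

  by-cases : Dec (b₁ ∈ D₂) → Dec (c₁ ∈ D₂) → ∃ λ D → D LM.∈ 𝒟 × Skips _⊏_ D (A - a) u
  by-cases (yes b₁∈D₂) _ =
    D₂ , D₂∈ , u∉D₂ , (b₁ , ⊏-trans b₁⊏a a⊏u , b₁∈A-a , b₁∈D₂) , right₂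
  by-cases (no b₁∉D₂) (no c₁∉D₂) =
    contradiction (alt D₁∈ D₂∈ b₁⊏a a⊏c₁ b₁∈D₁ b₁∉D₂ c₁∈D₁ c₁∉D₂ a∈D₂) a∉D₁
  by-cases (no b₁∉D₂) (yes c₁∈D₂) with compare c₁ u
  ... | tri< c₁⊏u _ _ = D₂ , D₂∈ , u∉D₂ , (c₁ , c₁⊏u , after a⊏c₁ c₁∈A , c₁∈D₂) , right₂
  ... | tri≈ _ refl _ = contradiction c₁∈D₂ u∉D₂
  ... | tri> _ _ u⊏c₁ = D₁ , D₁∈ , u∉D₁ , (b₁ , ⊏-trans b₁⊏a a⊏u , b₁∈A-a , b₁∈D₁) ,
                        (c₁ , u⊏c₁ , after a⊏c₁ c₁∈A , c₁∈D₁)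
    where
    -- Otherwise `b₁`, `a`, `u` would alternate between `D₁` and `D₂`.
    u∉D₁ : u ∉ D₁
    u∉D₁ u∈D₁ = a∉D₁ (alt D₁∈ D₂∈ b₁⊏a a⊏u b₁∈D₁ b₁∉D₂ u∈D₁ u∉D₂ a∈D₂)

module Unskippability (𝒟 : Hypergraph n) (alt : AlternationFree _<_ 𝒟) where

  Skippable : Subset n → Fin n → Set
  Skippable A u = Any (λ D → Skips _<_ D A u) 𝒟

  skippable? : ∀ A → Decidable (Skippable A)
  skippable? A u = Any.any? (λ D → ¬? (u ∈? D)
    ×-dec any? (λ b → (b <? u) ×-dec (b ∈? A) ×-dec (b ∈? D))
    ×-dec any? (λ c → (u <? c) ×-dec (c ∈? A) ×-dec (c ∈? D))) 𝒟

  flip-alt : AlternationFree {n} (flip _<_) 𝒟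
  flip-alt A∈ B∈ x>y y>z x∈A x∉B z∈A z∉B = alt A∈ B∈ y>z x>y z∈A z∉B x∈A x∉B

  flip-skips : ∀ {D A : Subset n} {u} → Skips _<_ D A u → Skips (flip _<_) D A u
  flip-skips (u∉D , left , right) = u∉D , right , left

  -- This allows skippable vertices to be deleted one by one: whatever is unskippable in the end was
  -- so in the original set. Only a skip with `a` as an end needs `reroute`, in the flipped order
  -- when `a` is the right end.
  skippable-delete : ∀ {A a u} → Skippable A a → Skippable A u → u ≢ a → Skippable (A - a) u
  skippable-delete {A} {a} {u} sa su u≢a with find sa | find su
  ... | D₁ , D₁∈ , s₁
      | D₂ , D₂∈ , u∉D₂ , left₂@(b , b<u , b∈A , b∈D₂) , right₂@(c , u<c , c∈A , c∈D₂)
    with b ≟ a | c ≟ a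
  ... | yes refl | _ =
      let D , D∈ , s = reroute <-isStrictTotalOrder alt D₁∈ D₂∈ s₁ b∈D₂ b<u u∉D₂ right₂
      in lose D∈ s
  ... | no _ | yes refl =
      let D , D∈ , u∉D , right , left = reroute (Flip.isStrictTotalOrder (<-isStrictTotalOrder {n}))
            flip-alt D₁∈ D₂∈ (flip-skips s₁) c∈D₂ u<c u∉D₂ left₂
      in lose D∈ (u∉D , left , right)
  ... | no b≢a | no c≢a =
      lose D₂∈ (u∉D₂ , (b , b<u , x∈p∧x≢y⇒x∈p-y b∈A b≢a , b∈D₂)
                     , (c , u<c , x∈p∧x≢y⇒x∈p-y c∈A c≢a , c∈D₂))

  -- Suppose the given point is `a` itself. If `D` missed both ends of a skip of `a` by `D₁`, then
  -- `b`, `a`, `c` would alternate between `D₁` and `D`; so one of the ends replaces `a`.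
  trace-survives : ∀ {A D a x} → D LM.∈ 𝒟 → Skippable A a → x ∈ A → x ∈ D →
    ∃ λ y → y ∈ A - a × y ∈ D
  trace-survives {A} {D} {a} {x} D∈ sa x∈A x∈D with x ≟ a
  ... | no x≢a = x , x∈p∧x≢y⇒x∈p-y x∈A x≢a , x∈D
  ... | yes refl with find sa
  ...   | D₁ , D₁∈ , a∉D₁ , (b , b<a , b∈A , b∈D₁) , (c , a<c , c∈A , c∈D₁)
      with b ∈? D | c ∈? D
  ...   | yes b∈D | _ = b , x∈p∧x≢y⇒x∈p-y b∈A (λ b≡a → <-irrefl b≡a b<a) , b∈D
  ...   | no _ | yes c∈D = c , x∈p∧x≢y⇒x∈p-y c∈A (λ c≡a → <-irrefl (sym c≡a) a<c) , c∈D
  ...   | no b∉D | no c∉D =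
        contradiction (alt D₁∈ D∈ b<a a<c b∈D₁ b∉D c∈D₁ c∉D x∈D) a∉D₁

  -- Delete skippable vertices of `A` until none is left. The trace on `D` stays nonempty, and any
  -- vertex of it then serves as `u`.
  ∃-unskippable : ∀ A {D} → D LM.∈ 𝒟 → (∃ λ x → x ∈ A × x ∈ D) →
    ∃ λ u → u ∈ A × u ∈ D × ¬ Skippable A u
  ∃-unskippable A {D} D∈ = go A (⊂-wellFounded A)
    where
    go : ∀ A → Acc _⊂_ A → (∃ λ x → x ∈ A × x ∈ D) → ∃ λ u → u ∈ A × u ∈ D × ¬ Skippable A u
    go A (acc rs) (x , x∈A , x∈D) with any? (λ a → (a ∈? A) ×-dec skippable? A a)
    ... | no ∄a = x , x∈A , x∈D , λ sx → ∄a (x , x∈A , sx)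
    ... | yes (a , a∈A , sa)
        with go (A - a) (rs (x∈p⇒p-x⊂p a∈A)) (trace-survives D∈ sa x∈A x∈D)
    ...   | u , u∈A-a , u∈D , ¬su =
          u , p─q⊆p A _ u∈A-a , u∈D , λ su → ¬su (skippable-delete sa su (u≢a u∈A-a))
      where
      u≢a : ∀ {u} → u ∈ A - a → u ≢ a
      u≢a u∈A-a refl = x∉p-x A a u∈A-a

  least-unskippable : ∀ {A m} → (∀ {j} → j ∈ A → ¬ j < m) → ¬ Skippable A m
  least-unskippable least sm with find sm
  ... | _ , _ , _ , (b , b<m , b∈A , _) , _ = least b∈A b<m

  greatest-unskippable : ∀ {A m} → (∀ {j} → j ∈ A → ¬ m < j) → ¬ Skippable A m
  greatest-unskippable greatest sm with find sm
  ... | _ , _ , _ , _ , (c , m<c , c∈A , _) = greatest c∈A m<c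

-- ABA-freeness and complements

ABA-free⇒alternationFree : {F : Hypergraph n} → ABA-free F → AlternationFree _<_ F
ABA-free⇒alternationFree aba {A} {B} A∈ B∈ {y = y} x<y y<z x∈A x∉B z∈A z∉B y∈B with y ∈? A
... | yes y∈A = y∈A
... | no y∉A = contradiction ((x∈A , x∉B) , (z∈A , z∉B) , (y∈B , y∉A))
                 (aba _ _ A∈ B∈ _ _ _ x<y y<z)

-- A vertex in `A` but not in `B` is in `∁ B` but not in `∁ A`, so alternations survive
-- complementation with the two edges exchanged.
alternationFree-∁ : {F 𝒟 : Hypergraph n} → AlternationFree _<_ F →
  (∀ {D} → D LM.∈ 𝒟 → ∁ D LM.∈ F) → AlternationFree _<_ 𝒟
alternationFree-∁ alt ∁∈F A∈ B∈ x<y y<z x∈A x∉B z∈A z∉B y∈B =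
  x∉∁p⇒x∈p λ y∈∁A → x∈∁p⇒x∉p
    (alt (∁∈F B∈) (∁∈F A∈) x<y y<z (x∉p⇒x∈∁p x∉B) (x∈p⇒x∉∁p x∈A)
         (x∉p⇒x∈∁p z∉B) (x∈p⇒x∉∁p z∈A) y∈∁A) y∈B

-- Differences that straddle a gap

-- Gap v lies between the vertices numbered v and v + 1.
Straddles : ℕ → Pred (Fin n) 0ℓ → Set
Straddles v P = (∃ λ i → P i × toℕ i ≤ v) × (∃ λ j → P j × v <ℕ toℕ j)

-- B lies strictly above A at the gap v.
Above : ℕ → Rel (Subset n) 0ℓ
Above v A B = Straddles v (λ i → i ∈ A × i ∉ B)

above? : ∀ v → Decidable₂ (Above {n} v)
above? v A B = any? (λ i → ((i ∈? A) ×-dec ¬? (i ∈? B)) ×-dec (toℕ i ≤? v))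
         ×-dec any? (λ i → ((i ∈? A) ×-dec ¬? (i ∈? B)) ×-dec (v <ℕ? toℕ i))

above-irrefl : ∀ {v} {A : Subset n} → ¬ Above v A A
above-irrefl ((_ , (i∈A , i∉A) , _) , _) = i∉A i∈A

-- On each side of the gap one of the two given witnesses works. If neither does on the left, then
-- `l₁`, `l₂`, `r₁` alternate between `A` and `B`, or `l₂`, `l₁`, `r₂` between `B` and `C`,
-- depending on the order of `l₁` and `l₂`; the right side is symmetric.
above-trans : ∀ {v} {F : Hypergraph n} → AlternationFree _<_ F →
  ∀ {A B C} → A LM.∈ F → B LM.∈ F → C LM.∈ F → Above v A B → Above v B C → Above v A C
above-trans {n} {v} alt {A} {B} {C} A∈ B∈ C∈
  ((l₁ , (l₁∈A , l₁∉B) , l₁≤v) , (r₁ , (r₁∈A , r₁∉B) , v<r₁))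
  ((l₂ , (l₂∈B , l₂∉C) , l₂≤v) , (r₂ , (r₂∈B , r₂∉C) , v<r₂)) = left , right
  where
  left : ∃ λ i → (i ∈ A × i ∉ C) × toℕ i ≤ v
  left with l₁ ∈? C | l₂ ∈? A
  ... | no l₁∉C | _ = l₁ , (l₁∈A , l₁∉C) , l₁≤v
  ... | yes _ | yes l₂∈A = l₂ , (l₂∈A , l₂∉C) , l₂≤v
  ... | yes l₁∈C | no l₂∉A with <-cmp l₁ l₂
  ...   | tri≈ _ refl _ = contradiction l₂∈B l₁∉B
  ...   | tri< l₁<l₂ _ _ = contradiction
          (alt A∈ B∈ l₁<l₂ (ℕ.≤-<-trans l₂≤v v<r₁) l₁∈A l₁∉B r₁∈A r₁∉B l₂∈B) l₂∉A
  ...   | tri> _ _ l₂<l₁ = contradiction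
          (alt B∈ C∈ l₂<l₁ (ℕ.≤-<-trans l₁≤v v<r₂) l₂∈B l₂∉C r₂∈B r₂∉C l₁∈C) l₁∉B

  right : ∃ λ i → (i ∈ A × i ∉ C) × v <ℕ toℕ i
  right with r₁ ∈? C | r₂ ∈? A
  ... | no r₁∉C | _ = r₁ , (r₁∈A , r₁∉C) , v<r₁
  ... | yes _ | yes r₂∈A = r₂ , (r₂∈A , r₂∉C) , v<r₂
  ... | yes r₁∈C | no r₂∉A with <-cmp r₁ r₂
  ...   | tri≈ _ refl _ = contradiction r₂∈B r₁∉B
  ...   | tri> _ _ r₂<r₁ = contradiction
          (alt A∈ B∈ (ℕ.≤-<-trans l₁≤v v<r₂) r₂<r₁ l₁∈A l₁∉B r₁∈A r₁∉B r₂∈B) r₂∉A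
  ...   | tri< r₁<r₂ _ _ = contradiction
          (alt B∈ C∈ (ℕ.≤-<-trans l₂≤v v<r₁) r₁<r₂ l₂∈B l₂∉C r₂∈B r₂∉C r₁∈C) r₁∉B

-- The sweep

module Sweep {F : Hypergraph n} (alt : AlternationFree _<_ F)
  (A₀ : Subset n) (𝒰₀ 𝒟 : Hypergraph n)
  (𝒰⊆F : ∀ {E} → E LM.∈ (A₀ ∷ 𝒰₀) → E LM.∈ F) (∁𝒟⊆F : ∀ {E} → E LM.∈ 𝒟 → ∁ E LM.∈ F)
  (common : ∀ {A B C} → A LM.∈ (A₀ ∷ 𝒰₀) ++ 𝒟 → B LM.∈ (A₀ ∷ 𝒰₀) ++ 𝒟 →
            C LM.∈ (A₀ ∷ 𝒰₀) ++ 𝒟 → ∃ λ v → v ∈ A × v ∈ B × v ∈ C)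
  where

  open Unskippability 𝒟 (alternationFree-∁ alt ∁𝒟⊆F)

  𝒰 : Hypergraph n
  𝒰 = A₀ ∷ 𝒰₀

  up : ∀ {E} → E LM.∈ 𝒰 → E LM.∈ 𝒰 ++ 𝒟
  up = ∈-++⁺ˡ

  down : ∀ {E} → E LM.∈ 𝒟 → E LM.∈ 𝒰 ++ 𝒟
  down = ∈-++⁺ʳ 𝒰

  HitByTwo : Set
  HitByTwo = ∃₂ λ p q → ∀ {E} → E LM.∈ 𝒰 ++ 𝒟 → p ∈ E ⊎ q ∈ E

  -- The bound excludes vertex `v` itself, although it precedes the gap; this strictness is what
  -- rules out `LeftOf` at the first gap.
  LeftOf : ℕ → Set
  LeftOf v = ∃₂ λ A D → A LM.∈ 𝒰 × D LM.∈ 𝒟 × (∀ {w} → w ∈ A → w ∈ D → toℕ w <ℕ v)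

  -- Unlike `LeftOf`, this records the hull vertex `q`, at which the clash with a later `LeftOf` is
  -- derived.
  RightOf : ℕ → Set
  RightOf v = ∃₂ λ A D → A LM.∈ 𝒰 × D LM.∈ 𝒟 × ∃ λ q → v <ℕ toℕ q ×
    q ∈ A × q ∉ D × ¬ Skippable A q × (∀ {w} → w ∈ A → w ∈ D → q < w)

  -- q ∈ D′ because D′ does not skip q in A, and q ∈ A′ because A′ and ∁ D do not alternate;
  -- but A′ ∩ D′ lies to the left of q.
  right-left-clash : ∀ {v} → RightOf v → ¬ LeftOf (suc v)
  right-left-clash (A , D , A∈ , D∈ , q , v<q , q∈A , q∉D , ¬sq , right)
                   (A′ , D′ , A′∈ , D′∈ , left)
    with common (up A∈) (down D∈) (down D′∈) | common (up A∈) (up A′∈) (down D′∈)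
       | common (up A′∈) (down D′∈) (down D∈) | common (up A∈) (down D∈) (up A′∈)
  ... | r , r∈A , r∈D , r∈D′ | l , l∈A , l∈A′ , l∈D′
      | l′ , l′∈A′ , l′∈D′ , l′∈D | r′ , r′∈A , r′∈D , r′∈A′
    = ℕ.<⇒≱ (left q∈A′ q∈D′) v<q
    where
    q∈A′ : q ∈ A′
    q∈A′ = alt (𝒰⊆F A′∈) (∁𝒟⊆F D∈) (ℕ.<-≤-trans (left l′∈A′ l′∈D′) v<q) (right r′∈A r′∈D)
      l′∈A′ (x∈p⇒x∉∁p l′∈D) r′∈A′ (x∈p⇒x∉∁p r′∈D) (x∉p⇒x∈∁p q∉D)

    q∈D′ : q ∈ D′
    q∈D′ with q ∈? D′
    ... | yes q∈D′ = q∈D′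
    ... | no q∉D′ = contradiction
          (lose D′∈ (q∉D′ , (l , ℕ.<-≤-trans (left l∈A′ l∈D′) v<q , l∈A , l∈D′)
                          , (r , right r∈A r∈D , r∈A , r∈D′))) ¬sq

  -- A candidate exists because the least vertex of `A` has no vertex of `A` before it and so cannot
  -- be skipped.
  hull-before : ∀ v {A} → (∃ λ i → i ∈ A × toℕ i ≤ v) →
    ∃ λ p → (p ∈ A × toℕ p ≤ v × ¬ Skippable A p) ×
            (∀ {j} → j ∈ A × toℕ j ≤ v × ¬ Skippable A j → ¬ p < j)
  hull-before v {A} (i , i∈A , i≤v) with ∃-least (_∈? A) (i , i∈A)
  ... | m , m∈A , least = ∃-greatest
        (λ j → (j ∈? A) ×-dec (toℕ j ≤? v) ×-dec ¬? (skippable? A j))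
        (m , m∈A , ℕ.≤-trans (ℕ.≮⇒≥ (least i∈A)) i≤v , least-unskippable least)

  hull-after : ∀ v {A} → (∃ λ i → i ∈ A × v <ℕ toℕ i) →
    ∃ λ q → (q ∈ A × v <ℕ toℕ q × ¬ Skippable A q) ×
            (∀ {j} → j ∈ A × v <ℕ toℕ j × ¬ Skippable A j → ¬ j < q)
  hull-after v {A} (i , i∈A , v<i) with ∃-greatest (_∈? A) (i , i∈A)
  ... | m , m∈A , greatest = ∃-least
        (λ j → (j ∈? A) ×-dec (v <ℕ? toℕ j) ×-dec ¬? (skippable? A j))
        (m , m∈A , ℕ.<-≤-trans v<i (ℕ.≮⇒≥ (greatest i∈A)) , greatest-unskippable greatest)

  hit-or-shift : ∀ v → (∀ {E} → E LM.∈ 𝒰 ++ 𝒟 → Straddles v (_∈ E)) →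
    HitByTwo ⊎ (LeftOf v ⊎ RightOf v)
  hit-or-shift v straddles
    with ∃-maximal-∈ (above? v) above-irrefl A₀ 𝒰₀
           (λ a∈ b∈ c∈ → above-trans alt (𝒰⊆F a∈) (𝒰⊆F b∈) (𝒰⊆F c∈))
  ... | A , A∈ , highest
    with hull-before v (proj₁ (straddles (up A∈))) | hull-after v (proj₂ (straddles (up A∈)))
  ... | p , (p∈A , p≤v , ¬sp) , p-last | q , (q∈A , v<q , ¬sq) , q-first
    with Any.any? (λ D → ¬? (p ∈? D) ×-dec ¬? (q ∈? D)) 𝒟
  ... | no ∄D = inj₁ (p , q , hit)
    where
    hit : ∀ {E} → E LM.∈ 𝒰 ++ 𝒟 → p ∈ E ⊎ q ∈ E
    hit {E} E∈ with p ∈? E | q ∈? E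
    ... | yes p∈E | _ = inj₁ p∈E
    ... | no _ | yes q∈E = inj₂ q∈E
    ... | no p∉E | no q∉E with ∈-++⁻ 𝒰 E∈
    -- An up edge missing both `p` and `q` would be strictly above `A`, with these two as witnesses.
    ...   | inj₁ E∈𝒰 = contradiction
            ((p , (p∈A , p∉E) , p≤v) , (q , (q∈A , q∉E) , v<q)) (highest E∈𝒰)
    ...   | inj₂ E∈𝒟 = contradiction (lose E∈𝒟 (p∉E , q∉E)) ∄D
  ... | yes ∃D with find ∃D
  ...   | D , D∈ , p∉D , q∉D with common (up A∈) (up A∈) (down D∈)
  -- No unskippable vertex of `A` lies strictly between `p` and `q`, and `D` misses both, so `u` is
  -- before `p` or after `q`. In the first case a common point of `A` and `D` beyond `p` would make
  -- `D` skip `p`; the second case is the mirror image.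
  ...     | x , x∈A , _ , x∈D with ∃-unskippable A D∈ (x , x∈A , x∈D)
  ...       | u , u∈A , u∈D , ¬su with toℕ u ≤? v
  ...         | yes u≤v = inj₂ (inj₁ (A , D , A∈ , D∈ , λ w∈A w∈D → ℕ.<-≤-trans (left w∈A w∈D) p≤v))
    where
    u<p : u < p
    u<p with <-cmp u p
    ... | tri< u<p _ _ = u<p
    ... | tri≈ _ refl _ = contradiction u∈D p∉D
    ... | tri> _ _ p<u = contradiction p<u (p-last (u∈A , u≤v , ¬su))

    left : ∀ {w} → w ∈ A → w ∈ D → w < p
    left {w} w∈A w∈D with <-cmp w p
    ... | tri< w<p _ _ = w<p
    ... | tri≈ _ refl _ = contradiction w∈D p∉D
    ... | tri> _ _ p<w = contradiction
          (lose D∈ (p∉D , (u , u<p , u∈A , u∈D) , (w , p<w , w∈A , w∈D))) ¬sp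
  ...         | no u≰v = inj₂ (inj₂ (A , D , A∈ , D∈ , q , v<q , q∈A , q∉D , ¬sq , right))
    where
    q<u : q < u
    q<u with <-cmp q u
    ... | tri< q<u _ _ = q<u
    ... | tri≈ _ refl _ = contradiction u∈D q∉D
    ... | tri> _ _ u<q = contradiction u<q (q-first (u∈A , ℕ.≰⇒> u≰v , ¬su))

    right : ∀ {w} → w ∈ A → w ∈ D → q < w
    right {w} w∈A w∈D with <-cmp q w
    ... | tri< q<w _ _ = q<w
    ... | tri≈ _ refl _ = contradiction w∈D q∉D
    ... | tri> _ _ w<q = contradiction
          (lose D∈ (q∉D , (w , w<q , w∈A , w∈D) , (u , q<u , u∈A , u∈D))) ¬sq

  -- Every edge meets the intersection of `A` and `D`, which lies beyond `q`, itself beyond `v`;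
  -- hence the edge has a vertex beyond `suc v`.
  straddles-suc : ∀ {v} → RightOf v → (∀ {E} → E LM.∈ 𝒰 ++ 𝒟 → Straddles v (_∈ E)) →
    ∀ {E} → E LM.∈ 𝒰 ++ 𝒟 → Straddles (suc v) (_∈ E)
  straddles-suc (A , D , A∈ , D∈ , q , v<q , _ , _ , _ , A∩D>q) straddles E∈
    with straddles E∈ | common (up A∈) (down D∈) E∈
  ... | (i , i∈E , i≤v) , _ | w , w∈A , w∈D , w∈E =
    (i , i∈E , ℕ.m≤n⇒m≤1+n i≤v) , (w , w∈E , ℕ.≤-<-trans v<q (A∩D>q w∈A w∈D))

  -- `k` is fuel. Once it runs out, `v` is at least `n`, and no edge can have a vertex beyond the
  -- gap.
  sweep : ∀ k v → n ≤ k + v → (∀ {E} → E LM.∈ 𝒰 ++ 𝒟 → Straddles v (_∈ E)) →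
    ¬ LeftOf v → HitByTwo
  sweep zero v n≤v straddles _ =
    let _ , (j , _ , v<j) = straddles (up (here refl))
    in contradiction (toℕ<n j) (ℕ.≤⇒≯ (ℕ.≤-trans n≤v (ℕ.<⇒≤ v<j)))
  sweep (suc k) v n≤k+v straddles ¬left = continue (hit-or-shift v straddles)
    where
    continue : HitByTwo ⊎ (LeftOf v ⊎ RightOf v) → HitByTwo
    continue (inj₁ hit) = hit
    continue (inj₂ (inj₁ left)) = contradiction left ¬left
    continue (inj₂ (inj₂ right)) = sweep k (suc v)
      (subst (n ≤_) (sym (ℕ.+-suc k v)) n≤k+v) (straddles-suc right straddles) (right-left-clash right)

  -- The first gap

  least-of : ∀ {E} → E LM.∈ 𝒰 ++ 𝒟 → ∃ λ m → m ∈ E × ¬ (∃ λ j → j ∈ E × j < m)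
  least-of {E} E∈ with common E∈ E∈ E∈
  ... | x , x∈E , _ with ∃-least (_∈? E) (x , x∈E)
  ...   | m , m∈E , least = m , m∈E , λ (_ , j∈E , j<m) → least j∈E j<m

  ∃-greatest-least : ∃ λ b → (∃ λ E → E LM.∈ 𝒰 ++ 𝒟 × (∀ {j} → j ∈ E → ¬ j < b)) ×
    (∀ {E} → E LM.∈ 𝒰 ++ 𝒟 → ∃ λ i → i ∈ E × toℕ i ≤ toℕ b)
  ∃-greatest-least
    with ∃-greatest
           -- The predicate does not put `b` in `E`; its greatest solution is still the largest of
           -- the least vertices of the edges.
           (λ b → Any.any? (λ E → ¬? (any? (λ j → (j ∈? E) ×-dec (j <? b)))) (𝒰 ++ 𝒟))
           (let m , _ , E≥m = least-of (up (here refl)) in m , lose (up (here refl)) E≥m)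
  ... | b , ∃B , greatest with find ∃B
  ...   | B , B∈ , B≥b = b , (B , B∈ , λ j∈B j<b → B≥b (_ , j∈B , j<b)) , meets
    where
    meets : ∀ {E} → E LM.∈ 𝒰 ++ 𝒟 → ∃ λ i → i ∈ E × toℕ i ≤ toℕ b
    meets E∈ with least-of E∈
    ... | m , m∈E , E≥m = m , m∈E , ℕ.≮⇒≥ (greatest (lose E∈ E≥m))

  -- The sweep starts just after `b`. There `LeftOf` fails because `A`, `D` and `B` share a vertex,
  -- which cannot precede `b`.
  hit-by-two : HitByTwo
  hit-by-two with ∃-greatest-least
  ... | b , (B , B∈ , B≥b) , meets
    with Any.any? (λ E → ¬? (any? (λ j → (j ∈? E) ×-dec (b <? j)))) (𝒰 ++ 𝒟)
  ... | no ∄E = sweep n (toℕ b) (ℕ.m≤m+n n (toℕ b)) straddles ¬left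
    where
    straddles : ∀ {E} → E LM.∈ 𝒰 ++ 𝒟 → Straddles (toℕ b) (_∈ E)
    straddles {E} E∈ with any? (λ j → (j ∈? E) ×-dec (b <? j))
    ... | yes after = meets E∈ , after
    ... | no ∄j = contradiction (lose E∈ ∄j) ∄E

    ¬left : ¬ LeftOf (toℕ b)
    ¬left (A , D , A∈ , D∈ , left) with common (up A∈) (down D∈) B∈
    ... | w , w∈A , w∈D , w∈B = B≥b w∈B (left w∈A w∈D)
  -- Here `B` has nothing before `b` and `E′` nothing after it, so they share at most `b`, which by
  -- the triple condition lies in every edge.
  ... | yes ∃E with find ∃E
  ...   | E′ , E′∈ , ∄j = b , b , λ E∈ → inj₁ (b∈ E∈)
    where
    b∈ : ∀ {E} → E LM.∈ 𝒰 ++ 𝒟 → b ∈ E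
    b∈ E∈ with common B∈ E′∈ E∈
    ... | w , w∈B , w∈E′ , w∈E with <-cmp w b
    ...   | tri< w<b _ _ = contradiction w<b (B≥b w∈B)
    ...   | tri≈ _ refl _ = w∈E
    ...   | tri> _ _ b<w = contradiction (w , w∈E′ , b<w) ∄j

-- Reduction of the theorem to the sweep

ABA-free-⊤ : {F : Hypergraph n} → ABA-free F → ABA-free (⊤ ∷ F)
ABA-free-⊤ aba A B (there A∈) (there B∈) = aba A B A∈ B∈
ABA-free-⊤ aba _ B (here refl) _ x y z _ _ (_ , _ , (_ , y∉⊤)) = y∉⊤ ∈⊤
ABA-free-⊤ aba A _ (there _) (here refl) x y z _ _ ((_ , x∉⊤) , _) = x∉⊤ ∈⊤

mainTheorem4 : (n : ℕ) (H : Hypergraph n) → IsPseudohalfplane H →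
    (∀ (A B C : Subset n) → A LM.∈ H → B LM.∈ H → C LM.∈ H →
    ∃ λ (v : Fin n) → v ∈ A × v ∈ B × v ∈ C) →
    Σ (List (Fin n)) λ S → length S ≤ 2 ×
    (∀ (E : Subset n) → E LM.∈ H → Any (λ v → v ∈ E) S)
-- `Fin n` may be empty here, so no vertex is chosen.
mainTheorem4 n [] _ _ = [] , z≤n , λ _ ()
mainTheorem4 n H@(H₀ ∷ _) (F , aba , H⊆F∪F̄) common = p ∷ q ∷ [] , s≤s (s≤s z≤n) ,
    λ E E∈H → [ here , (λ q∈E → there (here q∈E)) ]′ (hit (H⊆𝒰∪𝒟 E∈H))
  where
  open DecMembership (≡-dec {n = n} _≟ᵇ_) using () renaming (_∈?_ to _∈ᴸ?_)

  𝒰₀ 𝒟 : Hypergraph n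
  𝒰₀ = filter (_∈ᴸ? F) H
  𝒟 = filter (_∈ᴸ? complementFamily F) H

  -- Adjoining ⊤ ensures that there is an up edge at all.
  𝒰⊆F : ∀ {E} → E LM.∈ (⊤ ∷ 𝒰₀) → E LM.∈ (⊤ ∷ F)
  𝒰⊆F (here refl) = here refl
  𝒰⊆F (there E∈) = there (proj₂ (∈-filter⁻ (_∈ᴸ? F) {xs = H} E∈))

  ∁𝒟⊆F : ∀ {E} → E LM.∈ 𝒟 → ∁ E LM.∈ (⊤ ∷ F)
  ∁𝒟⊆F E∈ with ∈-map⁻ ∁ (proj₂ (∈-filter⁻ (_∈ᴸ? complementFamily F) {xs = H} E∈))
  ... | G , G∈F , refl =
    there (subst (LM._∈ F) (sym (¬-involutive (∪-∩-booleanAlgebra n) G)) G∈F)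

  H⊆𝒰∪𝒟 : ∀ {E} → E LM.∈ H → E LM.∈ (⊤ ∷ 𝒰₀) ++ 𝒟
  H⊆𝒰∪𝒟 E∈H with H⊆F∪F̄ _ E∈H
  ... | inj₁ E∈F = there (∈-++⁺ˡ (∈-filter⁺ (_∈ᴸ? F) E∈H E∈F))
  ... | inj₂ E∈F̄ = there (∈-++⁺ʳ 𝒰₀ (∈-filter⁺ (_∈ᴸ? complementFamily F) E∈H E∈F̄))

  -- This carries the triple condition over to `⊤`, which need not belong to `H`: the edge `H₀`
  -- stands in for it.
  contains-edge : ∀ {E} → E LM.∈ (⊤ ∷ 𝒰₀) ++ 𝒟 → ∃ λ E′ → E′ LM.∈ H × (∀ {v} → v ∈ E′ → v ∈ E)
  contains-edge (here refl) = H₀ , here refl , λ _ → ∈⊤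
  contains-edge (there E∈) with ∈-++⁻ 𝒰₀ E∈
  ... | inj₁ E∈𝒰 = _ , proj₁ (∈-filter⁻ (_∈ᴸ? F) {xs = H} E∈𝒰) , λ v∈ → v∈
  ... | inj₂ E∈𝒟 = _ , proj₁ (∈-filter⁻ (_∈ᴸ? complementFamily F) {xs = H} E∈𝒟) , λ v∈ → v∈

  common′ : ∀ {A B C} → A LM.∈ (⊤ ∷ 𝒰₀) ++ 𝒟 → B LM.∈ (⊤ ∷ 𝒰₀) ++ 𝒟 →
    C LM.∈ (⊤ ∷ 𝒰₀) ++ 𝒟 → ∃ λ v → v ∈ A × v ∈ B × v ∈ C
  common′ A∈ B∈ C∈ with contains-edge A∈ | contains-edge B∈ | contains-edge C∈
  ... | A , A∈H , A⊆ | B , B∈H , B⊆ | C , C∈H , C⊆ with common A B C A∈H B∈H C∈H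
  ...   | v , v∈A , v∈B , v∈C = v , A⊆ v∈A , B⊆ v∈B , C⊆ v∈C

  open Sweep (ABA-free⇒alternationFree (ABA-free-⊤ aba)) ⊤ 𝒰₀ 𝒟 𝒰⊆F ∁𝒟⊆F common′
    using (hit-by-two)

  p q : Fin n
  p = proj₁ hit-by-two
  q = proj₁ (proj₂ hit-by-two)

  hit : ∀ {E} → E LM.∈ (⊤ ∷ 𝒰₀) ++ 𝒟 → p ∈ E ⊎ q ∈ E
  hit = proj₂ (proj₂ hit-by-two)
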